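{- Let $(S,K,I)$ be a split graph such that $\Phi(S)$ is simple and complete, with $K=\bigcup_{v\in I}N_S(v)$. Put $\omega=|K|$, $\alpha=|I|$, assume $\alpha\ge2$, and let $U$ be the set of universal vertices of $S$. Then: (1) $S$ is homogeneous; (2) if $d$ is the common degree in $S$ of the vertices of $I$, then $1\le d\le \omega-1$; (3) $|U|\in\{d-1,\ d+1-\alpha\}$; (4) $|U|=d-1$ if and only if $\omega=\alpha+d-1$; (5) $|U|=d+1-\alpha$ if and only if $\omega=d+1$; (6) $\omega=\alpha+|U|$ (in particular $\omega\ge\alpha$); (7) $S$ is active if and only if $U=\varnothing$; (8) if $S$ is active, then $\omega=\alpha$ and $d\in\{1,\omega-1\}$; (9) if $\omega=\alpha$ or $d=1$, then $S$ is active.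
   Context: All graphs are finite and simple. A split graph is a graph $S$ whose vertex set is a disjoint union $V(S)=K\,\dot\cup\,I$ with $K$ a clique and $I$ an independent set; $(K,I)$ is called a bipartition of $S$, and $(S,K,I)$ denotes $S$ together with this fixed bipartition. A 2-switch in a graph $G$ is performed on four distinct vertices $a,b,c,d$ with $ab,cd\in E(G)$ and $ac,bd\notin E(G)$: it deletes $ab,cd$ and adds $ac,bd$; $a,b,c,d$ are said to participate in it. A vertex is active in $G$ if it participates in some 2-switch on $G$; $G$ is active if all its vertices are active. A vertex is universal if it is adjacent to all other vertices. For a split graph $(S,K,I)$ and distinct $u,v\in I$, $\sigma_{uv}(S)$ is the number of induced subgraphs of $S$ isomorphic to $P_4$ containing both $u$ and $v$. The factor graph $\Phi(S)$ is the loopless multigraph with vertex set $I$ having exactly $\sigma_{uv}(S)$ parallel edges between $u$ and $v$; it is simple if $\sigma_{uv}(S)\in\{0,1\}$ for all $u,v$. Graph notions (connected, complete, clique, etc.) applied to $\Phi(S)$ refer to its underlying simple graph, in which $u\sim v$ iff $\sigma_{uv}(S)\ge1$. A vertex $w$ of $(S,K,I)$ is swing if $N_S(w)=K\setminus\{w\}$. $(S,K,I)$ is balanced if $|K|=\omega(S)$ and $|I|=\alpha(S)$; it is known that $S$ is balanced iff it has no swing vertex. $(S,K,I)$ is homogeneous if it is balanced and all vertices of $I$ have the same degree in $S$. -}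

module Defs where

open import Data.Bool using (if_then_else_)
open import Data.Fin using (Fin; zero; suc; toℕ)
open import Data.Fin.Properties using (all?; any?) renaming (_≟_ to _≟ᶠ_)
open import Data.Fin.Subset
  using (Subset; inside; outside; _∈_; _∪_; _∩_; ⊤; Empty; ∣_∣)
open import Data.Fin.Subset.Properties using (_∈?_)
open import Data.List using (List; []; _∷_; _++_; map; filter; length)
open import Data.List.Extrema.Nat using (max)
open import Data.List.Membership.Propositional using () renaming (_∈_ to _∈ˡ_)
open import Data.List.Properties using (filter-≐)
open import Data.List.Relation.Unary.Unique.Propositional using (Unique)
open import Data.Nat using (ℕ; zero; suc; _≤_; _≤?_)
open import Data.Nat.Properties using (1+n≢n) renaming (_≟_ to _≟ⁿ_)
open import Data.Product using (∃; Σ; _×_; _,_; proj₁; proj₂; uncurry)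
open import Data.Product.Properties using (Σ-≡,≡→≡)
open import Data.Sum using (_⊎_; inj₁; inj₂; [_,_]; swap)
open import Data.Vec using (Vec; []; _∷_; lookup; tabulate)
open import Data.Vec.Properties using (lookup∘tabulate)
open import Data.Vec.Properties.WithK using ([]=-irrelevant)
open import Function using (_∘_; _↔_; _⇔_; mk⇔; mk↔ₛ′; Inverse; Equivalence)
open import Level using (0ℓ)
open import Relation.Binary using (Rel) renaming (Decidable to Decidable₂)
open import Relation.Binary.PropositionalEquality
  using (_≡_; _≢_; refl; sym; trans; cong; cong₂; subst; subst₂)
open import Relation.Nullary.Decidable using (does-⇔; dec-true)
open import Relation.Nullary
  using (¬_; Dec; does; contradiction; ¬?; _×-dec_; _⊎-dec_; _→-dec_; map′)
open import Relation.Unary using (Pred; Decidable)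

record Graph (V : Set) : Set₁ where
  field
    Adj    : Rel V 0ℓ
    adj?   : Decidable₂ Adj
    adjSym : ∀ {u v} → Adj u v → Adj v u
    irrefl : ∀ {v} → ¬ Adj v v

record _≅_ {V W : Set} (G : Graph V) (H : Graph W) : Set where
  private
    module G = Graph G
    module H = Graph H
  field
    bijection : V ↔ W
  open Inverse bijection public using (to; from)
  field
    preserves : ∀ u v → G.Adj u v ⇔ H.Adj (to u) (to v)

_[_] : ∀ {n} → Graph (Fin n) → (W : Subset n) → Graph (∃ (_∈ W))
G [ W ] = record
  { Adj    = λ u v → Adj (proj₁ u) (proj₁ v)
  ; adj?   = λ u v → adj? (proj₁ u) (proj₁ v)
  ; adjSym = adjSym
  ; irrefl = irrefl
  } where open Graph G

path : ∀ n → Graph (Fin n)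
path n = record
  { Adj    = λ i j → toℕ j ≡ suc (toℕ i) ⊎ toℕ i ≡ suc (toℕ j)
  ; adj?   = λ i j → (toℕ j ≟ⁿ suc (toℕ i)) ⊎-dec (toℕ i ≟ⁿ suc (toℕ j))
  ; adjSym = swap
  ; irrefl = [ 1+n≢n ∘ sym , 1+n≢n ∘ sym ]
  }

Complete : {V : Set} → Graph V → Set
Complete G = ∀ u v → u ≢ v → Adj u v
  where open Graph G

subsets : ∀ n → List (Subset n)
subsets zero    = [] ∷ []
subsets (suc n) = map (inside ∷_) (subsets n) ++ map (outside ∷_) (subsets n)

comprehension : ∀ {n} {P : Pred (Fin n) 0ℓ} → Decidable P → Subset n
comprehension P? = tabulate (does ∘ P?)

-- Isomorphism with an induced subgraph is decided by searching over the
-- vectors listing the images of the vertices.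

private
  anyVec? : ∀ {n} m {P : Pred (Vec (Fin n) m) 0ℓ} → Decidable P → Dec (∃ P)
  anyVec? zero    P? = map′ ([] ,_) (λ { ([] , p) → p }) (P? [])
  anyVec? (suc m) P? =
    map′ (λ { (x , xs , p) → x ∷ xs , p }) (λ { (x ∷ xs , p) → x , xs , p })
         (any? λ x → anyVec? m λ xs → P? (x ∷ xs))

  _⇔-dec_ : {A B : Set} → Dec A → Dec B → Dec (A ⇔ B)
  a? ⇔-dec b? =
    map′ (uncurry mk⇔) (λ e → Equivalence.to e , Equivalence.from e)
         ((a? →-dec b?) ×-dec (b? →-dec a?))

  ∃∈-≡ : ∀ {n} {W : Subset n} {u v : ∃ (_∈ W)} → proj₁ u ≡ proj₁ v → u ≡ v
  ∃∈-≡ p = Σ-≡,≡→≡ (p , []=-irrelevant _ _)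

  module _ {n m} (G : Graph (Fin n)) (W : Subset n) (H : Graph (Fin m)) where
    private
      module G = Graph G
      module H = Graph H

    Lists : Pred (Vec (Fin n) m) 0ℓ
    Lists xs = (∀ i → lookup xs i ∈ W)
             × (∀ v → v ∈ W → ∃ λ i → lookup xs i ≡ v)
             × (∀ i j → lookup xs i ≡ lookup xs j → i ≡ j)
             × (∀ i j → G.Adj (lookup xs i) (lookup xs j) ⇔ H.Adj i j)

    lists? : Decidable Lists
    lists? xs =
      all? (λ i → lookup xs i ∈? W)
      ×-dec all? (λ v → v ∈? W →-dec any? λ i → lookup xs i ≟ᶠ v)
      ×-dec all? (λ i → all? λ j → (lookup xs i ≟ᶠ lookup xs j) →-dec (i ≟ᶠ j))
      ×-dec all? (λ i → all? λ j → G.adj? (lookup xs i) (lookup xs j) ⇔-dec H.adj? i j)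

    lists⇒≅ : ∃ Lists → (G [ W ]) ≅ H
    lists⇒≅ (xs , mem , surj , inj , adj) = record
      { bijection = mk↔ₛ′ f g f∘g g∘f
      ; preserves = λ u v → subst₂ (λ x y → G.Adj x y ⇔ H.Adj (f u) (f v))
                              (cong proj₁ (g∘f u)) (cong proj₁ (g∘f v))
                              (adj (f u) (f v))
      }
      where
      f : ∃ (_∈ W) → Fin m
      f (v , v∈W) = proj₁ (surj v v∈W)
      g : Fin m → ∃ (_∈ W)
      g i = lookup xs i , mem i
      f∘g : ∀ i → f (g i) ≡ i
      f∘g i = inj _ _ (proj₂ (surj (lookup xs i) (mem i)))
      g∘f : ∀ v → g (f v) ≡ v
      g∘f (v , v∈W) = ∃∈-≡ (proj₂ (surj v v∈W))

    ≅⇒lists : (G [ W ]) ≅ H → ∃ Lists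
    ≅⇒lists iso = tabulate g , mem , surj , inj , adj
      where
      open _≅_ iso
      open Inverse bijection using (strictlyInverseˡ; strictlyInverseʳ)
      g : Fin m → Fin n
      g i = proj₁ (from i)
      eq : ∀ i → lookup (tabulate g) i ≡ g i
      eq = lookup∘tabulate g
      mem : ∀ i → lookup (tabulate g) i ∈ W
      mem i = subst (_∈ W) (sym (eq i)) (proj₂ (from i))
      surj : ∀ v → v ∈ W → ∃ λ i → lookup (tabulate g) i ≡ v
      surj v v∈W = to (v , v∈W) ,
        trans (eq (to (v , v∈W))) (cong proj₁ (strictlyInverseʳ (v , v∈W)))
      inj : ∀ i j → lookup (tabulate g) i ≡ lookup (tabulate g) j → i ≡ j
      inj i j p =
        trans (sym (strictlyInverseˡ i))
        (trans (cong to (∃∈-≡ (trans (sym (eq i)) (trans p (eq j)))))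
               (strictlyInverseˡ j))
      adj : ∀ i j → G.Adj (lookup (tabulate g) i) (lookup (tabulate g) j) ⇔ H.Adj i j
      adj i j = subst₂ (λ x y → G.Adj x y ⇔ H.Adj i j) (sym (eq i)) (sym (eq j))
                  (subst₂ (λ k l → G.Adj (g i) (g j) ⇔ H.Adj k l)
                    (strictlyInverseˡ i) (strictlyInverseˡ j)
                    (preserves (from i) (from j)))

_[_]≅?_ : ∀ {n m} (G : Graph (Fin n)) (W : Subset n) (H : Graph (Fin m)) →
          Dec ((G [ W ]) ≅ H)
_[_]≅?_ {m = m} G W H =
  map′ (lists⇒≅ G W H) (≅⇒lists G W H) (anyVec? m (lists? G W H))

module _ {n} (G : Graph (Fin n)) where
  open Graph G

  neighbourhood : Fin n → Subset n
  neighbourhood v = comprehension (adj? v)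

  degree : Fin n → ℕ
  degree v = ∣ neighbourhood v ∣

  Clique : Subset n → Set
  Clique C = ∀ u v → u ∈ C → v ∈ C → u ≢ v → Adj u v

  clique? : Decidable Clique
  clique? C = all? λ u → all? λ v →
    u ∈? C →-dec v ∈? C →-dec ¬? (u ≟ᶠ v) →-dec adj? u v

  Independent : Subset n → Set
  Independent A = ∀ u v → u ∈ A → v ∈ A → ¬ Adj u v

  independent? : Decidable Independent
  independent? A = all? λ u → all? λ v →
    u ∈? A →-dec v ∈? A →-dec ¬? (adj? u v)

  cliqueNumber : ℕ
  cliqueNumber = max 0 (map ∣_∣ (filter clique? (subsets n)))

  independenceNumber : ℕ
  independenceNumber = max 0 (map ∣_∣ (filter independent? (subsets n)))

  Universal : Fin n → Set
  Universal v = ∀ w → w ≢ v → Adj v w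

  universal? : Decidable Universal
  universal? v = all? λ w → ¬? (w ≟ᶠ v) →-dec adj? v w

  universals : Subset n
  universals = comprehension universal?

  -- The conditions under which ab, cd may be replaced by ac, bd.
  record TwoSwitch (a b c d : Fin n) : Set where
    field
      distinct : Unique (a ∷ b ∷ c ∷ d ∷ [])
      ab       : Adj a b
      cd       : Adj c d
      ac       : ¬ Adj a c
      bd       : ¬ Adj b d

  ActiveVertex : Fin n → Set
  ActiveVertex v = ∃ λ a → ∃ λ b → ∃ λ c → ∃ λ d →
    TwoSwitch a b c d × v ∈ˡ (a ∷ b ∷ c ∷ d ∷ [])

  Active : Set
  Active = ∀ v → ActiveVertex v

  InducedP₄Through : (u v : Fin n) → Subset n → Set
  InducedP₄Through u v W = u ∈ W × v ∈ W × (G [ W ]) ≅ path 4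

  inducedP₄Through? : ∀ u v → Decidable (InducedP₄Through u v)
  inducedP₄Through? u v W = u ∈? W ×-dec v ∈? W ×-dec (G [ W ]≅? path 4)

  -- Induced subgraphs are counted by their vertex sets.
  σ : Fin n → Fin n → ℕ
  σ u v = length (filter (inducedP₄Through? u v) (subsets n))

  σ-sym : ∀ u v → σ u v ≡ σ v u
  σ-sym u v = cong length
    (filter-≐ (inducedP₄Through? u v) (inducedP₄Through? v u)
      ((λ { (p , q , r) → q , p , r }) , (λ { (p , q , r) → q , p , r }))
      (subsets n))

record SplitGraph (n : ℕ) : Set₁ where
  field
    graph       : Graph (Fin n)
    K I         : Subset n
    cover       : K ∪ I ≡ ⊤
    disjoint    : Empty (K ∩ I)
    clique      : Clique graph K
    independent : Independent graph I

record Multigraph (V : Set) : Set where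
  field
    mult     : V → V → ℕ
    multSym  : ∀ u v → mult u v ≡ mult v u
    loopless : ∀ v → mult v v ≡ 0

Simple : {V : Set} → Multigraph V → Set
Simple M = ∀ u v → mult u v ≤ 1
  where open Multigraph M

underlying : {V : Set} → Multigraph V → Graph V
underlying M = record
  { Adj    = λ u v → 1 ≤ mult u v
  ; adj?   = λ u v → 1 ≤? mult u v
  ; adjSym = λ {u} {v} → subst (1 ≤_) (multSym u v)
  ; irrefl = λ {v} p → contradiction (subst (1 ≤_) (loopless v) p) λ ()
  } where open Multigraph M

module _ {n} (S : SplitGraph n) where
  open SplitGraph S

  -- σ only counts edges between distinct vertices: on the diagonal it would
  -- count the induced P₄'s through a single vertex.
  Φ : Multigraph (∃ (_∈ I))
  Φ = record { mult = mult ; multSym = multSym ; loopless = loopless }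
    where
    mult : ∃ (_∈ I) → ∃ (_∈ I) → ℕ
    mult (u , _) (v , _) = if does (u ≟ᶠ v) then 0 else σ graph u v

    multSym : ∀ u v → mult u v ≡ mult v u
    multSym (u , _) (v , _) =
      cong₂ (if_then 0 else_) (does-⇔ (mk⇔ sym sym) (u ≟ᶠ v) (v ≟ᶠ u)) (σ-sym graph u v)

    loopless : ∀ v → mult v v ≡ 0
    loopless (v , _) = cong (if_then 0 else σ graph v v) (dec-true (v ≟ᶠ v) refl)

  Balanced : Set
  Balanced = ∣ K ∣ ≡ cliqueNumber graph × ∣ I ∣ ≡ independenceNumber graph

  CommonDegree : ℕ → Set
  CommonDegree d = ∀ v → v ∈ I → degree graph v ≡ d

  Homogeneous : Set
  Homogeneous = Balanced × ∃ CommonDegree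

{-# OPTIONS --safe #-}

-- An induced P₄ through u, v ∈ I is a path u–x–y–v with x ∈ N(u) ∖ N(v) and
-- y ∈ N(v) ∖ N(u), so simplicity and completeness of Φ(S) say that
-- |N(u) ∖ N(v)| = 1 for all distinct u, v ∈ I.  Such a family is either a
-- sunflower (two of the sets meet in the intersection of all of them) or a
-- cosunflower (each set misses a single element of K).  In the first case
-- "k ∈ N(w)" and in the second case "k ∉ N(w)" is a one-to-one correspondence
-- between w ∈ I and k ∈ K ∖ U, hence ω = α + |U|; moreover d = |U| + 1 in the
-- first case and ω = d + 1 in the second.  Everything else is arithmetic.
module Submission where

open import Defs
open import Data.Bool using (if_then_else_)
open import Data.Empty using (⊥)
open import Data.Fin using (Fin; zero; suc)
open import Data.Fin.Patterns using (0F; 1F; 2F; 3F)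
open import Data.Fin.Properties using (all?; any?; _≟_; 0≢1+n; suc-injective)
open import Data.Fin.Subset
  using (Subset; inside; outside; _∈_; _∉_; _⊆_; _─_; _-_; ⁅_⁆; Empty; ∣_∣)
open import Data.Fin.Subset.Properties
  using ( _∈?_; nonempty?; Empty-unique; ∣⊥∣≡0; ∈⊤; x∈p∪q⁻; x∈p∩q⁺; x∈⁅x⁆; ∣⁅x⁆∣≡1
        ; p⊆q⇒∣p∣≤∣q∣; p⊂q⇒∣p∣<∣q∣; p─q⊆p; x∈p∧x∉q⇒x∈p─q; x∈p∧x≢y⇒x∈p-y
        ; x∈p⇒∣p-x∣<∣p∣; drop-∷-⊆ )
open import Data.Integer using (+_; _⊖_) renaming (_≤_ to _≤ᶻ_)
import Data.Integer as ℤ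
import Data.Integer.Properties as ℤ
open import Data.List using ([]; _∷_; length; filter; map)
open import Data.List.Extrema.Nat using (max; max≈v⁺)
open import Data.List.Membership.Propositional using () renaming (_∈_ to _∈ˡ_)
open import Data.List.Membership.Propositional.Properties
  using (∈-filter⁺; ∈-map⁺; ∈-++⁺ˡ; ∈-++⁺ʳ)
open import Data.List.Relation.Unary.All as All using ([]; _∷_)
open import Data.List.Relation.Unary.All.Properties using (all-filter; map⁺)
open import Data.List.Relation.Unary.AllPairs using ([]; _∷_)
open import Data.List.Relation.Unary.Any using (here; there)
open import Data.Nat using (ℕ; zero; suc; _+_; _∸_; _≤_; z≤n; s≤s)
open import Data.Nat.Properties
  using ( ≤-trans; ≤-antisym; m≤m+n; m≤n+m; m+n∸n≡m; n≤0⇒n≡0; 1+n≰n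
        ; +-comm; +-assoc; +-suc; +-cancelˡ-≡; +-cancelʳ-≡; +-cancelʳ-≤ )
open import Data.Product using (∃; _×_; _,_; proj₁; proj₂)
open import Data.Product.Properties using (Σ-≡,≡→≡)
open import Data.Sum as Sum using (_⊎_; inj₁; inj₂)
open import Data.Vec using ([]; _∷_; lookup; here; there)
open import Data.Vec.Properties using (lookup∘tabulate; lookup⇒[]=; []=⇒lookup)
open import Data.Vec.Properties.WithK using ([]=-irrelevant)
open import Function using (_∘_; _⇔_; mk⇔; mk↔ₛ′; flip; Inverse; Equivalence)
open import Level using (0ℓ)
open import Relation.Binary.PropositionalEquality
  using (_≡_; _≢_; refl; sym; trans; cong; subst; subst₂; ≢-sym; module ≡-Reasoning)
open import Relation.Nullary
  using (¬_; Dec; yes; no; does; contradiction; ¬?; _×-dec_; _⊎-dec_; _→-dec_)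
open import Relation.Nullary.Decidable
  using (dec-true; dec-false; decidable-stable; from-yes)
open import Relation.Unary using (Pred; Decidable)

-- Cardinalities of finite subsets.

private
  variable
    m n : ℕ

-- Induction on `p`: the first element of `p` uses up a partner `j`, and injectivity keeps the
-- remaining elements away from `j`, so they still have partners in `q - j`. Using a relation
-- instead of a map allows adjacency itself to serve as the correspondence, in both directions.
injective-relation⇒∣p∣≤∣q∣ :
  (p : Subset m) (q : Subset n) (R : Fin m → Fin n → Set) →
  (∀ {i} → i ∈ p → ∃ λ j → j ∈ q × R i j) →
  (∀ {i i′ j} → i ∈ p → i′ ∈ p → j ∈ q → R i j → R i′ j → i ≡ i′) →
  ∣ p ∣ ≤ ∣ q ∣
injective-relation⇒∣p∣≤∣q∣ []            q R total inj = z≤n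
injective-relation⇒∣p∣≤∣q∣ (outside ∷ p) q R total inj =
  injective-relation⇒∣p∣≤∣q∣ p q (R ∘ suc) (total ∘ there)
    λ i∈p i′∈p j∈q r r′ → suc-injective (inj (there i∈p) (there i′∈p) j∈q r r′)
injective-relation⇒∣p∣≤∣q∣ (inside ∷ p)  q R total inj with total here
... | j , j∈q , r = ≤-trans (s≤s ∣p∣≤∣q-j∣) (x∈p⇒∣p-x∣<∣p∣ j∈q)
  where
  total′ : ∀ {i} → i ∈ p → ∃ λ k → k ∈ (q - j) × R (suc i) k
  total′ i∈p with total (there i∈p)
  ... | k , k∈q , r′ =
    k , x∈p∧x≢y⇒x∈p-y k∈q (λ { refl → 0≢1+n (inj here (there i∈p) j∈q r r′) }) , r′

  ∣p∣≤∣q-j∣ : ∣ p ∣ ≤ ∣ q - j ∣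
  ∣p∣≤∣q-j∣ = injective-relation⇒∣p∣≤∣q∣ p (q - j) (R ∘ suc) total′
    λ i∈p i′∈p k∈q-j r r′ → suc-injective
      (inj (there i∈p) (there i′∈p) (p─q⊆p q ⁅ j ⁆ k∈q-j) r r′)

∣insert∣ : {p q : Subset n} {x : Fin n} → q ⊆ p → x ∈ p → x ∉ q →
           (∀ {y} → y ∈ p → y ∈ q ⊎ y ≡ x) → ∣ p ∣ ≡ suc ∣ q ∣
∣insert∣ {n} {p} {q} {x} q⊆p x∈p x∉q p⊆q+x =
  -- In `inside ∷ q` the new element `zero` stands for `x`, so this set has the size of `q` with `x`
  -- added.
  ≤-antisym (injective-relation⇒∣p∣≤∣q∣ p (inside ∷ q) R total inj)
            (p⊂q⇒∣p∣<∣q∣ (q⊆p , x , x∈p , x∉q))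
  where
  R : Fin n → Fin (suc n) → Set
  R y zero    = y ≡ x
  R y (suc z) = y ≡ z

  total : ∀ {y} → y ∈ p → ∃ λ z → z ∈ (inside ∷ q) × R y z
  total {y} y∈p with p⊆q+x y∈p
  ... | inj₁ y∈q = suc y , there y∈q , refl
  ... | inj₂ y≡x = zero , here , y≡x

  inj : ∀ {y y′ z} → y ∈ p → y′ ∈ p → z ∈ (inside ∷ q) → R y z → R y′ z → y ≡ y′
  inj {z = zero}  _ _ _ r r′ = trans r (sym r′)
  inj {z = suc _} _ _ _ r r′ = trans r (sym r′)

x∈p─q⇒x∉q : (p q : Subset n) → ∀ {x} → x ∈ p ─ q → x ∉ q
x∈p─q⇒x∉q (_ ∷ p) (_ ∷ q) (there x∈p─q) (there x∈q) = x∈p─q⇒x∉q p q x∈p─q x∈q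

∣p∣≡∣p─q∣+∣q∣ : (p q : Subset n) → q ⊆ p → ∣ p ∣ ≡ ∣ p ─ q ∣ + ∣ q ∣
∣p∣≡∣p─q∣+∣q∣ []            []            q⊆p = refl
∣p∣≡∣p─q∣+∣q∣ (inside ∷ p)  (inside ∷ q)  q⊆p =
  trans (cong suc (∣p∣≡∣p─q∣+∣q∣ p q (drop-∷-⊆ q⊆p))) (sym (+-suc _ _))
∣p∣≡∣p─q∣+∣q∣ (inside ∷ p)  (outside ∷ q) q⊆p =
  cong suc (∣p∣≡∣p─q∣+∣q∣ p q (drop-∷-⊆ q⊆p))
∣p∣≡∣p─q∣+∣q∣ (outside ∷ p) (outside ∷ q) q⊆p = ∣p∣≡∣p─q∣+∣q∣ p q (drop-∷-⊆ q⊆p)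
∣p∣≡∣p─q∣+∣q∣ (outside ∷ p) (inside ∷ q)  q⊆p with q⊆p here
... | ()

Empty⇒∣p∣≡0 : {p : Subset n} → Empty p → ∣ p ∣ ≡ 0
Empty⇒∣p∣≡0 {n} e = trans (cong ∣_∣ (Empty-unique e)) (∣⊥∣≡0 n)

∣p∣≡0⇒Empty : {p : Subset n} → ∣ p ∣ ≡ 0 → Empty p
∣p∣≡0⇒Empty {p = p} ∣p∣≡0 (x , x∈p) =
  contradiction (subst (suc ∣ p - x ∣ ≤_) ∣p∣≡0 (x∈p⇒∣p-x∣<∣p∣ x∈p)) λ ()

2≤∣p∣⇒another : {p : Subset n} → 2 ≤ ∣ p ∣ → ∀ x → ∃ λ y → y ∈ p × y ≢ x
2≤∣p∣⇒another {p = p} 2≤∣p∣ x with any? (λ y → y ∈? p ×-dec ¬? (y ≟ x))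
... | yes ∃y = ∃y
... | no ∄y  = contradiction (≤-trans 2≤∣p∣ ∣p∣≤1) 1+n≰n
  where
  p⊆⁅x⁆ : p ⊆ ⁅ x ⁆
  p⊆⁅x⁆ {y} y∈p with y ≟ x
  ... | yes refl = x∈⁅x⁆ x
  ... | no y≢x   = contradiction (y , y∈p , y≢x) ∄y

  ∣p∣≤1 : ∣ p ∣ ≤ 1
  ∣p∣≤1 = subst (∣ p ∣ ≤_) (∣⁅x⁆∣≡1 x) (p⊆q⇒∣p∣≤∣q∣ p⊆⁅x⁆)

-- Comprehensions, and maxima and counts over all subsets.

module _ {P : Pred (Fin n) 0ℓ} (P? : Decidable P) where

  ∈-comprehension⁺ : ∀ {x} → P x → x ∈ comprehension P?
  ∈-comprehension⁺ {x} px =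
    lookup⇒[]= x _ (trans (lookup∘tabulate (does ∘ P?) x) (dec-true (P? x) px))

  ∈-comprehension⁻ : ∀ {x} → x ∈ comprehension P? → P x
  ∈-comprehension⁻ {x} x∈ with P? x | trans (sym (lookup∘tabulate (does ∘ P?) x)) ([]=⇒lookup x∈)
  ... | yes px | _ = px

∈-subsets : (p : Subset n) → p ∈ˡ subsets n
∈-subsets []            = here refl
∈-subsets (inside ∷ p)  = ∈-++⁺ˡ (∈-map⁺ (inside ∷_) (∈-subsets p))
∈-subsets (outside ∷ p) = ∈-++⁺ʳ (map (inside ∷_) (subsets _)) (∈-map⁺ (outside ∷_) (∈-subsets p))

module _ {P : Pred (Subset n) 0ℓ} (P? : Decidable P) where

  maximum⇒∣p∣≡max : ∀ {p} → P p → (∀ {q} → P q → ∣ q ∣ ≤ ∣ p ∣) →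
                    ∣ p ∣ ≡ max 0 (map ∣_∣ (filter P? (subsets n)))
  maximum⇒∣p∣≡max {p} Pp bound = sym (max≈v⁺
    (∈-map⁺ ∣_∣ (∈-filter⁺ P? (∈-subsets p) Pp))
    (map⁺ (All.map bound (all-filter P? (subsets n))))
    -- The default value of `max` is 0, which lies below every cardinality.
    z≤n)

  1≤count⇒∃ : 1 ≤ length (filter P? (subsets n)) → ∃ P
  1≤count⇒∃ 1≤count with filter P? (subsets n) | all-filter P? (subsets n)
  1≤count⇒∃ (s≤s _) | p ∷ _ | Pp ∷ _ = p , Pp

  count≤1⇒unique : length (filter P? (subsets n)) ≤ 1 → ∀ {p q} → P p → P q → p ≡ q
  count≤1⇒unique count≤1 {p} {q} Pp Pq
    with filter P? (subsets n) | ∈-filter⁺ P? (∈-subsets p) Pp | ∈-filter⁺ P? (∈-subsets q) Pq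
  ... | _ ∷ [] | here p≡ | here q≡ = trans p≡ (sym q≡)
  count≤1⇒unique (s≤s ()) _ _ | _ ∷ _ ∷ _ | _ | _

-- `⊖` subtracts naturals with an integer result, so nothing is truncated; this moves differences
-- such as d + 1 - α to additive equations in `ℕ`.
+≡⊖ : ∀ a b c → (+ a ≡ b ⊖ c) ⇔ (a + c ≡ b)
+≡⊖ a b c = mk⇔ to λ { refl → sym (trans (ℤ.⊖-≥ (m≤n+m c a)) (cong +_ (m+n∸n≡m a c))) }
  where
  to : + a ≡ b ⊖ c → a + c ≡ b
  to a≡b⊖c = ℤ.+-injective (begin
    + (a + c)         ≡⟨ cong (ℤ._+ + c) a≡b⊖c ⟩
    (b ⊖ c) ℤ.+ + c   ≡⟨ ℤ.distribˡ-⊖-+-pos c b c ⟩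
    (b + c) ⊖ c       ≡⟨ ℤ.⊖-≥ (m≤n+m c b) ⟩
    + (b + c ∸ c)     ≡⟨ cong +_ (m+n∸n≡m b c) ⟩
    + b               ∎)
    where open ≡-Reasoning

suc≤⇒≤⊖1 : ∀ {a b} → suc a ≤ b → (+ a) ≤ᶻ (b ⊖ 1)
suc≤⇒≤⊖1 (s≤s a≤b) = ℤ.+≤+ a≤b

-- Induced copies of a graph, and the path P₄.

image : (Fin m → Fin n) → Subset n
image f = comprehension λ x → any? λ i → f i ≟ x

∈-image⁺ : (f : Fin m → Fin n) → ∀ i → f i ∈ image f
∈-image⁺ f i = ∈-comprehension⁺ (λ x → any? λ i → f i ≟ x) (i , refl)

∈-image⁻ : (f : Fin m → Fin n) → ∀ {x} → x ∈ image f → ∃ λ i → f i ≡ x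
∈-image⁻ f = ∈-comprehension⁻ (λ x → any? λ i → f i ≟ x)

module _ (G : Graph (Fin n)) (H : Graph (Fin m)) (f : Fin m → Fin n)
         (injective : ∀ i j → f i ≡ f j → i ≡ j)
         (adj⇔ : ∀ i j → Graph.Adj G (f i) (f j) ⇔ Graph.Adj H i j) where

  image-≅ : (G [ image f ]) ≅ H
  image-≅ = record
    { bijection = mk↔ₛ′ to from (λ i → injective _ _ (f∘to (from i))) from∘to
    ; preserves = λ u v → subst₂ (λ x y → Graph.Adj G x y ⇔ Graph.Adj H (to u) (to v))
                            (f∘to u) (f∘to v) (adj⇔ (to u) (to v))
    }
    where
    preimage : (v : ∃ (_∈ image f)) → ∃ λ i → f i ≡ proj₁ v
    preimage (_ , v∈) = ∈-image⁻ f v∈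
    to : ∃ (_∈ image f) → Fin m
    to v = proj₁ (preimage v)
    f∘to : ∀ v → f (to v) ≡ proj₁ v
    f∘to v = proj₂ (preimage v)
    from : Fin m → ∃ (_∈ image f)
    from i = f i , ∈-image⁺ f i
    from∘to : ∀ v → from (to v) ≡ v
    from∘to v = Σ-≡,≡→≡ (f∘to v , []=-irrelevant _ _)

private
  module P₄ = Graph (path 4)

-- Settled by exhaustive search. It makes any map from P₄ that preserves and reflects adjacency
-- injective: positions with equal images have equal neighbourhoods.
P₄-twin-free : ∀ i j → (∀ k → (P₄.Adj i k → P₄.Adj j k) × (P₄.Adj j k → P₄.Adj i k)) → i ≡ j
P₄-twin-free = from-yes (all? λ i → all? λ j →
  (all? λ k → (P₄.adj? i k →-dec P₄.adj? j k) ×-dec (P₄.adj? j k →-dec P₄.adj? i k))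
  →-dec (i ≟ j))

-- In a split graph the last alternative is impossible for j ∈ I, whose
-- neighbours are pairwise adjacent.
P₄-separates : ∀ i j → i ≡ j ⊎ P₄.Adj i j ⊎ (∃ λ k → P₄.Adj i k × ¬ P₄.Adj j k)
                     ⊎ (∃ λ k → ∃ λ l → k ≢ l × P₄.Adj j k × P₄.Adj j l × ¬ P₄.Adj k l)
P₄-separates = from-yes (all? λ i → all? λ j →
  (i ≟ j) ⊎-dec P₄.adj? i j
  ⊎-dec (any? λ k → P₄.adj? i k ×-dec ¬? (P₄.adj? j k))
  ⊎-dec (any? λ k → any? λ l →
          ¬? (k ≟ l) ×-dec P₄.adj? j k ×-dec P₄.adj? j l ×-dec ¬? (P₄.adj? k l)))

-- Lets `P₄-adj⇔` be proved by a table of sixteen entries, each an edge or a non-edge as the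
-- decision procedure computes.
if-does⇒⇔ : {A B : Set} (b? : Dec B) → (if does b? then A else ¬ A) → A ⇔ B
if-does⇒⇔ (yes b) a  = mk⇔ (λ _ → b) (λ _ → a)
if-does⇒⇔ (no ¬b) ¬a = mk⇔ (λ a → contradiction a ¬a) (λ b → contradiction b ¬b)

-- Split graphs: induced P₄'s against differences of neighbourhoods.

module SplitGraphProperties {n} (S : SplitGraph n) where
  open SplitGraph S
  open Graph graph

  I∌K : ∀ {v} → v ∈ I → v ∉ K
  I∌K v∈I v∈K = disjoint (_ , x∈p∩q⁺ (v∈K , v∈I))

  K⊎I : ∀ v → v ∈ K ⊎ v ∈ I
  K⊎I v = x∈p∪q⁻ K I (subst (v ∈_) (sym cover) ∈⊤)

  neighbour∈K : ∀ {v k} → v ∈ I → Adj v k → k ∈ K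
  neighbour∈K {v} {k} v∈I v~k with K⊎I k
  ... | inj₁ k∈K = k∈K
  ... | inj₂ k∈I = contradiction v~k (independent v k v∈I k∈I)

  infix 4 _∈N_∖N_
  _∈N_∖N_ : Fin n → Fin n → Fin n → Set
  x ∈N u ∖N v = Adj u x × ¬ Adj v x

  ∈∖⇒≢ : ∀ {u v x} → x ∈N u ∖N v → u ≢ v
  ∈∖⇒≢ (u~x , v≁x) refl = v≁x u~x

  module _ {u v x y} (u∈I : u ∈ I) (v∈I : v ∈ I)
           (x∈ : x ∈N u ∖N v) (y∈ : y ∈N v ∖N u) where

    private
      u~x = proj₁ x∈
      v≁x = proj₂ x∈
      v~y = proj₁ y∈
      u≁y = proj₂ y∈
      x∈K = neighbour∈K u∈I u~x
      y∈K = neighbour∈K v∈I v~y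
      u≁v = independent u v u∈I v∈I

      x≢y : x ≢ y
      x≢y refl = u≁y u~x

      x~y : Adj x y
      x~y = clique x y x∈K y∈K x≢y

    P₄-vertices : Fin 4 → Fin n
    P₄-vertices = lookup (u ∷ x ∷ y ∷ v ∷ [])

    P₄-adj⇔ : ∀ i j → Adj (P₄-vertices i) (P₄-vertices j) ⇔ P₄.Adj i j
    P₄-adj⇔ i j = if-does⇒⇔ (P₄.adj? i j) (agree i j)
      where
      agree : ∀ i j → if does (P₄.adj? i j) then Adj (P₄-vertices i) (P₄-vertices j)
                                            else ¬ Adj (P₄-vertices i) (P₄-vertices j)
      agree 0F 0F = irrefl
      agree 0F 1F = u~x
      agree 0F 2F = u≁y
      agree 0F 3F = u≁v
      agree 1F 0F = adjSym u~x
      agree 1F 1F = irrefl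
      agree 1F 2F = x~y
      agree 1F 3F = v≁x ∘ adjSym
      agree 2F 0F = u≁y ∘ adjSym
      agree 2F 1F = adjSym x~y
      agree 2F 2F = irrefl
      agree 2F 3F = adjSym v~y
      agree 3F 0F = u≁v ∘ adjSym
      agree 3F 1F = v≁x
      agree 3F 2F = v~y
      agree 3F 3F = irrefl

    ∈∖⇒inducedP₄ : InducedP₄Through graph u v (image P₄-vertices)
    ∈∖⇒inducedP₄ =
      ∈-image⁺ P₄-vertices 0F , ∈-image⁺ P₄-vertices 3F ,
      image-≅ graph (path 4) P₄-vertices injective P₄-adj⇔
      where
      injective : ∀ i j → P₄-vertices i ≡ P₄-vertices j → i ≡ j
      injective i j eq = P₄-twin-free i j λ k →
        Equivalence.to (P₄-adj⇔ j k) ∘ subst (λ w → Adj w _) eq ∘ Equivalence.from (P₄-adj⇔ i k) ,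
        Equivalence.to (P₄-adj⇔ i k) ∘ subst (λ w → Adj w _) (sym eq) ∘ Equivalence.from (P₄-adj⇔ j k)

    -- The end edges `u x` and `y v` of the path are exchanged for `u y` and `x v`.
    ∈∖⇒twoSwitch : TwoSwitch graph u x y v
    ∈∖⇒twoSwitch = record
      { distinct = ((λ { refl → I∌K u∈I x∈K }) ∷ (λ { refl → I∌K u∈I y∈K })
                     ∷ (λ { refl → u≁y v~y }) ∷ [])
                 ∷ (x≢y ∷ (λ { refl → I∌K v∈I x∈K }) ∷ [])
                 ∷ ((λ { refl → I∌K v∈I y∈K }) ∷ [])
                 ∷ [] ∷ []
      ; ab = u~x
      ; cd = adjSym v~y
      ; ac = u≁y
      ; bd = v≁x ∘ adjSym
      }

  -- `P₄-separates` is applied to the positions of `u` and `v` in the path. Only its third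
  -- alternative is compatible with `u ≢ v`, the independence of `I` and the clique `K`; its witness
  -- is carried back along the isomorphism.
  inducedP₄⇒∈∖ : ∀ {u v W} → u ∈ I → v ∈ I → u ≢ v → InducedP₄Through graph u v W →
                 ∃ λ x → x ∈N u ∖N v
  inducedP₄⇒∈∖ {u} {v} {W} u∈I v∈I u≢v (u∈W , v∈W , iso) = separate (P₄-separates (to u′) (to v′))
    where
    open _≅_ iso
    open Inverse bijection using (strictlyInverseˡ; strictlyInverseʳ)

    u′ v′ : ∃ (_∈ W)
    u′ = u , u∈W
    v′ = v , v∈W

    vertex : Fin 4 → Fin n
    vertex k = proj₁ (from k)

    adj⇔ : ∀ a k → Adj (proj₁ a) (vertex k) ⇔ P₄.Adj (to a) k
    adj⇔ a k = subst (λ l → Adj (proj₁ a) (vertex k) ⇔ P₄.Adj (to a) l)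
                 (strictlyInverseˡ k) (preserves a (from k))

    separate : _ → ∃ λ x → x ∈N u ∖N v
    separate (inj₁ eq) = contradiction
      (cong proj₁ (trans (sym (strictlyInverseʳ u′)) (trans (cong from eq) (strictlyInverseʳ v′))))
      u≢v
    separate (inj₂ (inj₁ i~j)) =
      contradiction (Equivalence.from (preserves u′ v′) i~j) (independent u v u∈I v∈I)
    separate (inj₂ (inj₂ (inj₁ (k , i~k , j≁k)))) =
      vertex k , Equivalence.from (adj⇔ u′ k) i~k , j≁k ∘ Equivalence.to (adj⇔ v′ k)
    separate (inj₂ (inj₂ (inj₂ (k , l , k≢l , j~k , j~l , k≁l)))) =
      contradiction (P₄-adj (clique (vertex k) (vertex l) (nbr∈K j~k) (nbr∈K j~l) distinct)) k≁l
      where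
      nbr∈K : ∀ {k} → P₄.Adj (to v′) k → vertex k ∈ K
      nbr∈K {k} = neighbour∈K v∈I ∘ Equivalence.from (adj⇔ v′ k)

      P₄-adj : Adj (vertex k) (vertex l) → P₄.Adj k l
      P₄-adj = subst (λ i → P₄.Adj i l) (strictlyInverseˡ k) ∘ Equivalence.to (adj⇔ (from k) l)

      distinct : vertex k ≢ vertex l
      distinct eq = k≢l (trans (sym (strictlyInverseˡ k)) (trans
        (cong to (Σ-≡,≡→≡ (eq , []=-irrelevant _ _))) (strictlyInverseˡ l)))

  mult≡σ : ∀ {u v} (u∈I : u ∈ I) (v∈I : v ∈ I) → u ≢ v →
           Multigraph.mult (Φ S) (u , u∈I) (v , v∈I) ≡ σ graph u v
  mult≡σ {u} {v} _ _ u≢v = cong (if_then 0 else σ graph u v) (dec-false (u ≟ v) u≢v)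

  complete⇒∖-nonempty : Complete (underlying (Φ S)) →
    ∀ {u v} → u ∈ I → v ∈ I → u ≢ v → ∃ λ x → x ∈N u ∖N v
  complete⇒∖-nonempty complete {u} {v} u∈I v∈I u≢v =
    inducedP₄⇒∈∖ u∈I v∈I u≢v (proj₂ (1≤count⇒∃ (inducedP₄Through? graph u v)
      (subst (1 ≤_) (mult≡σ u∈I v∈I u≢v) (complete (u , u∈I) (v , v∈I) (u≢v ∘ cong proj₁)))))

  -- `x` is a neighbour of `u`, and the only neighbour of `u` on the path u-x′-y-v is `x′`.
  x∈P₄⇒≡ : ∀ {u v x x′ y} (u∈I : u ∈ I) (v∈I : v ∈ I) (x′∈ : x′ ∈N u ∖N v) (y∈ : y ∈N v ∖N u) →
           x ∈N u ∖N v → x ∈ image (P₄-vertices u∈I v∈I x′∈ y∈) → x ≡ x′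
  x∈P₄⇒≡ {u} {v} u∈I v∈I x′∈ y∈ (u~x , v≁x) x∈image
    with ∈-image⁻ (P₄-vertices u∈I v∈I x′∈ y∈) x∈image
  ... | 0F , refl = contradiction u~x irrefl
  ... | 1F , refl = refl
  ... | 2F , refl = contradiction u~x (proj₂ y∈)
  ... | 3F , refl = contradiction u~x (independent u v u∈I v∈I)

  -- With the same `y`, both `x` and `x′` complete an induced P₄ through `u` and `v`. Simplicity
  -- gives the two paths the same vertex set.
  simple⇒∖-unique : Simple (Φ S) → ∀ {u v x x′ y} → u ∈ I → v ∈ I →
    x ∈N u ∖N v → x′ ∈N u ∖N v → y ∈N v ∖N u → x ≡ x′
  simple⇒∖-unique simple {u} {v} {x} u∈I v∈I x∈ x′∈ y∈ =
    x∈P₄⇒≡ u∈I v∈I x′∈ y∈ x∈ (subst (x ∈_) same-image (∈-image⁺ (P₄-vertices u∈I v∈I x∈ y∈) 1F))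
    where
    same-image : image (P₄-vertices u∈I v∈I x∈ y∈) ≡ image (P₄-vertices u∈I v∈I x′∈ y∈)
    same-image = count≤1⇒unique (inducedP₄Through? graph u v)
      (subst (_≤ 1) (mult≡σ u∈I v∈I (∈∖⇒≢ x∈)) (simple (u , u∈I) (v , v∈I)))
      (∈∖⇒inducedP₄ u∈I v∈I x∈ y∈) (∈∖⇒inducedP₄ u∈I v∈I x′∈ y∈)

  -- Neighbourhoods with one-element differences: universal vertices, degrees, balance.

  module UnitDifferences
    (∖-nonempty : ∀ {u v} → u ∈ I → v ∈ I → u ≢ v → ∃ λ x → x ∈N u ∖N v)
    (∖-unique   : ∀ {u v x x′} → u ∈ I → v ∈ I → x ∈N u ∖N v → x′ ∈N u ∖N v → x ≡ x′)
    (covered    : ∀ {k} → k ∈ K → ∃ λ v → v ∈ I × Adj v k)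
    (2≤α        : 2 ≤ ∣ I ∣)
    where

    U : Subset n
    U = universals graph

    another : ∀ v → ∃ λ w → w ∈ I × w ≢ v
    another = 2≤∣p∣⇒another 2≤α

    some∈I : ∃ (_∈ I)
    some∈I with nonempty? I
    ... | yes ne = ne
    ... | no  e  = contradiction (subst (2 ≤_) (Empty⇒∣p∣≡0 e) 2≤α) λ ()

    U⁺ : ∀ {k} → k ∈ K → (∀ {w} → w ∈ I → Adj w k) → k ∈ U
    U⁺ {k} k∈K ∀w~k = ∈-comprehension⁺ (universal? graph) universal
      where
      universal : Universal graph k
      universal w w≢k with K⊎I w
      ... | inj₁ w∈K = clique k w k∈K w∈K (≢-sym w≢k)
      ... | inj₂ w∈I = adjSym (∀w~k w∈I)

    U⊆K : U ⊆ K
    U⊆K {k} k∈U with K⊎I k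
    ... | inj₁ k∈K = k∈K
    ... | inj₂ k∈I with another k
    ...   | w , w∈I , w≢k = contradiction
            (∈-comprehension⁻ (universal? graph) k∈U w w≢k) (independent k w k∈I w∈I)

    U⇒adj : ∀ {k w} → k ∈ U → w ∈ I → Adj w k
    U⇒adj {k} {w} k∈U w∈I = adjSym (∈-comprehension⁻ (universal? graph) k∈U w
      λ { refl → I∌K w∈I (U⊆K k∈U) })

    U⁻ : ∀ {k} → k ∈ K → k ∉ U → ∃ λ w → w ∈ I × ¬ Adj w k
    U⁻ {k} k∈K k∉U with any? (λ w → w ∈? I ×-dec ¬? (adj? w k))
    ... | yes ∃w = ∃w
    ... | no  ∄w = contradiction
      (U⁺ k∈K λ {w} w∈I → decidable-stable (adj? w k) λ w≁k → ∄w (w , w∈I , w≁k)) k∉U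

    missed⇒∉U : ∀ {k w} → w ∈ I → ¬ Adj w k → k ∉ U
    missed⇒∉U w∈I w≁k k∈U = w≁k (U⇒adj k∈U w∈I)

    -- Excludes swing vertices in `I`: for any other `w`, the element of N(w) ∖ N(v) is missed by
    -- `v`.
    missing : ∀ {v} → v ∈ I → ∃ λ k → k ∈ K × ¬ Adj v k
    missing {v} v∈I with another v
    ... | w , w∈I , w≢v with ∖-nonempty w∈I v∈I w≢v
    ...   | k , w~k , v≁k = k , neighbour∈K w∈I w~k , v≁k

    ∈N : ∀ {v k} → Adj v k → k ∈ neighbourhood graph v
    ∈N {v} = ∈-comprehension⁺ (adj? v)

    N⇒adj : ∀ {v k} → k ∈ neighbourhood graph v → Adj v k
    N⇒adj {v} = ∈-comprehension⁻ (adj? v)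

    -- Common neighbours correspond to themselves, and the single element of N(u) ∖ N(v) to that of
    -- N(v) ∖ N(u).
    degree-≤ : ∀ {u v} → u ∈ I → v ∈ I → degree graph u ≤ degree graph v
    degree-≤ {u} {v} u∈I v∈I = injective-relation⇒∣p∣≤∣q∣ (N u) (N v) R total inj
      where
      N = neighbourhood graph

      R : Fin n → Fin n → Set
      R k l = k ≡ l ⊎ (¬ Adj v k × l ∈N v ∖N u)

      total : ∀ {k} → k ∈ N u → ∃ λ l → l ∈ N v × R k l
      total {k} k∈ with adj? v k
      ... | yes v~k = k , ∈N v~k , inj₁ refl
      ... | no  v≁k with ∖-nonempty v∈I u∈I (≢-sym (∈∖⇒≢ (N⇒adj k∈ , v≁k)))
      ...   | l , l∈ = l , ∈N (proj₁ l∈) , inj₂ (v≁k , l∈)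

      inj : ∀ {k k′ l} → k ∈ N u → k′ ∈ N u → l ∈ N v → R k l → R k′ l → k ≡ k′
      inj _  _   _ (inj₁ refl)    (inj₁ refl)     = refl
      inj k∈ _   _ (inj₁ refl)    (inj₂ (_ , l∈)) = contradiction (N⇒adj k∈) (proj₂ l∈)
      inj _  k′∈ _ (inj₂ (_ , l∈)) (inj₁ refl)    = contradiction (N⇒adj k′∈) (proj₂ l∈)
      inj k∈ k′∈ _ (inj₂ (v≁k , _)) (inj₂ (v≁k′ , _)) =
        ∖-unique u∈I v∈I (N⇒adj k∈ , v≁k) (N⇒adj k′∈ , v≁k′)

    -- A clique has at most one vertex in `I`; trading it for a vertex of `K` that it misses, which
    -- cannot lie in the clique, gives the first bound. Dually, an independent set has at most one
    -- vertex in `K`, which is traded for a neighbour in `I` supplied by `covered`.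
    balanced : Balanced S
    balanced = maximum⇒∣p∣≡max (clique? graph) clique clique-bound ,
               maximum⇒∣p∣≡max (independent? graph) independent independent-bound
      where
      clique-bound : ∀ {C} → Clique graph C → ∣ C ∣ ≤ ∣ K ∣
      clique-bound {C} C-clique = injective-relation⇒∣p∣≤∣q∣ C K R total inj
        where
        R : Fin n → Fin n → Set
        R c k = c ≡ k ⊎ (c ∈ I × ¬ Adj c k)

        total : ∀ {c} → c ∈ C → ∃ λ k → k ∈ K × R c k
        total {c} _ with K⊎I c
        ... | inj₁ c∈K = c , c∈K , inj₁ refl
        ... | inj₂ c∈I with missing c∈I
        ...   | k , k∈K , c≁k = k , k∈K , inj₂ (c∈I , c≁k)

        inj : ∀ {c c′ k} → c ∈ C → c′ ∈ C → k ∈ K → R c k → R c′ k → c ≡ c′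
        inj {c} {c′} c∈C c′∈C k∈K (inj₁ refl) (inj₁ refl) = refl
        inj {c} {c′} c∈C c′∈C k∈K (inj₁ refl) (inj₂ (c′∈I , c′≁c)) =
          contradiction (C-clique c′ c c′∈C c∈C λ { refl → I∌K c′∈I k∈K }) c′≁c
        inj {c} {c′} c∈C c′∈C k∈K (inj₂ (c∈I , c≁c′)) (inj₁ refl) =
          contradiction (C-clique c c′ c∈C c′∈C λ { refl → I∌K c∈I k∈K }) c≁c′
        inj {c} {c′} c∈C c′∈C k∈K (inj₂ (c∈I , _)) (inj₂ (c′∈I , _)) =
          decidable-stable (c ≟ c′) λ c≢c′ →
            independent c c′ c∈I c′∈I (C-clique c c′ c∈C c′∈C c≢c′)

      independent-bound : ∀ {A} → Independent graph A → ∣ A ∣ ≤ ∣ I ∣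
      independent-bound {A} A-independent = injective-relation⇒∣p∣≤∣q∣ A I R total inj
        where
        R : Fin n → Fin n → Set
        R a v = a ≡ v ⊎ (a ∈ K × Adj v a)

        total : ∀ {a} → a ∈ A → ∃ λ v → v ∈ I × R a v
        total {a} _ with K⊎I a
        ... | inj₂ a∈I = a , a∈I , inj₁ refl
        ... | inj₁ a∈K with covered a∈K
        ...   | v , v∈I , v~a = v , v∈I , inj₂ (a∈K , v~a)

        inj : ∀ {a a′ v} → a ∈ A → a′ ∈ A → v ∈ I → R a v → R a′ v → a ≡ a′
        inj {a} {a′} a∈A a′∈A _ (inj₁ refl) (inj₁ refl) = refl
        inj {a} {a′} a∈A a′∈A _ (inj₁ refl) (inj₂ (_ , a~a′)) =
          contradiction a~a′ (A-independent a a′ a∈A a′∈A)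
        inj {a} {a′} a∈A a′∈A _ (inj₂ (_ , a′~a)) (inj₁ refl) =
          contradiction a′~a (A-independent a′ a a′∈A a∈A)
        inj {a} {a′} a∈A a′∈A _ (inj₂ (a∈K , _)) (inj₂ (a′∈K , _)) =
          decidable-stable (a ≟ a′) λ a≢a′ →
            A-independent a a′ a∈A a′∈A (clique a a′ a∈K a′∈K a≢a′)

    commonDegree : CommonDegree S (degree graph (proj₁ some∈I))
    commonDegree v v∈I =
      ≤-antisym (degree-≤ v∈I (proj₂ some∈I)) (degree-≤ (proj₂ some∈I) v∈I)

    1≤degree : ∀ {v} → v ∈ I → 1 ≤ degree graph v
    1≤degree {v} v∈I with another v
    ... | w , w∈I , w≢v with ∖-nonempty v∈I w∈I (≢-sym w≢v)
    ...   | x , v~x , _ = ≤-trans (s≤s z≤n) (x∈p⇒∣p-x∣<∣p∣ (∈N v~x))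

    degree<ω : ∀ {v} → v ∈ I → suc (degree graph v) ≤ ∣ K ∣
    degree<ω {v} v∈I with missing v∈I
    ... | k , k∈K , v≁k = p⊂q⇒∣p∣<∣q∣ (neighbour∈K v∈I ∘ N⇒adj , k , k∈K , v≁k ∘ N⇒adj)

    -- The dichotomy between sunflowers and cosunflowers.

    Sunflower : Set
    Sunflower = ∀ {u v w k} → u ∈ I → v ∈ I → w ∈ I → u ≢ v → Adj u k → Adj v k → Adj w k

    -- Only uniqueness of the missed element is stated; its existence is `missing`.
    Cosunflower : Set
    Cosunflower = ∀ {w k k′} → w ∈ I → k ∈ K → k′ ∈ K → ¬ Adj w k → ¬ Adj w k′ → k ≡ k′

    module _ {u v w c} (u∈I : u ∈ I) (v∈I : v ∈ I) (w∈I : w ∈ I)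
             (u≢v : u ≢ v) (u~c : Adj u c) (v~c : Adj v c) where

      -- Let `y` be the element of N(v) ∖ N(u). If `y` is in N(w), then `y` and `z` agree as
      -- elements of N(w) ∖ N(u), but only `y` is in N(v). Otherwise `y` and `c` agree as elements
      -- of N(v) ∖ N(w), but only `c` is in N(u).
      ¬misses-and-exceeds : ∀ {z} → ¬ Adj w c → Adj w z → ¬ Adj u z → ¬ Adj v z → ⊥
      ¬misses-and-exceeds w≁c w~z u≁z v≁z with ∖-nonempty v∈I u∈I (≢-sym u≢v)
      ... | y , v~y , u≁y with adj? w y
      ...   | yes w~y = v≁z (subst (Adj v) (∖-unique w∈I u∈I (w~y , u≁y) (w~z , u≁z)) v~y)
      ...   | no  w≁y = u≁y (subst (Adj u) (∖-unique v∈I w∈I (v~c , w≁c) (v~y , w≁y)) u~c)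

    -- A failure of the sunflower property forces N(u) ∪ N(v) = K. If `k` were in neither set, some
    -- N(x) would contain it; by `¬misses-and-exceeds`, N(x) contains `c` and N(w) misses `k`. Then
    -- `c` and `k` agree as elements of N(x) ∖ N(w), although only `c` is in N(u).
    missed⇒covering : ∀ {u v w c} → u ∈ I → v ∈ I → w ∈ I → u ≢ v → Adj u c → Adj v c →
                      ¬ Adj w c → ∀ {k} → k ∈ K → ¬ Adj u k → Adj v k
    missed⇒covering {u} {v} {w} {c} u∈I v∈I w∈I u≢v u~c v~c w≁c {k} k∈K u≁k =
      decidable-stable (adj? v k) exceeded
      where
      exceeded : ¬ ¬ Adj v k
      exceeded v≁k with covered k∈K
      ... | x , x∈I , x~k = u≁k (subst (Adj u) (∖-unique x∈I w∈I (x~c , w≁c) (x~k , w≁k)) u~c)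
        where
        x~c : Adj x c
        x~c = decidable-stable (adj? x c) λ x≁c →
          ¬misses-and-exceeds u∈I v∈I x∈I u≢v u~c v~c x≁c x~k u≁k v≁k
        w≁k : ¬ Adj w k
        w≁k w~k = ¬misses-and-exceeds u∈I v∈I w∈I u≢v u~c v~c w≁c w~k u≁k v≁k

    module _ {u v} (u∈I : u ∈ I) (v∈I : v ∈ I)
             (covering : ∀ {k} → k ∈ K → ¬ Adj u k → Adj v k) where

      -- By `covering`, K ∖ N(u) equals N(v) ∖ N(u), so `l` is its only element. Missing `k` makes
      -- `w` different from `u`, so N(w) has an element outside N(u), and that element is `l`.
      ¬misses-both : ∀ {w k l} → w ∈ I → Adj u k → ¬ Adj w k → l ∈ K → ¬ Adj u l → Adj w l
      ¬misses-both {w} w∈I u~k w≁k l∈K u≁l with ∖-nonempty w∈I u∈I (≢-sym (∈∖⇒≢ (u~k , w≁k)))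
      ... | p , w~p , u≁p = subst (Adj w)
        (∖-unique v∈I u∈I (covering (neighbour∈K w∈I w~p) u≁p , u≁p) (covering l∈K u≁l , u≁l)) w~p

      -- Two elements missed by `w` that are both in N(u) agree in N(u) ∖ N(w); if both are outside
      -- N(u), they agree in N(v) ∖ N(w). `¬misses-both` excludes the mixed cases.
      covering⇒cosunflower : Cosunflower
      covering⇒cosunflower {w} {k} {k′} w∈I k∈K k′∈K w≁k w≁k′ with adj? u k | adj? u k′
      ... | yes u~k | yes u~k′ = ∖-unique u∈I w∈I (u~k , w≁k) (u~k′ , w≁k′)
      ... | yes u~k | no  u≁k′ = contradiction (¬misses-both w∈I u~k w≁k k′∈K u≁k′) w≁k′
      ... | no  u≁k | yes u~k′ = contradiction (¬misses-both w∈I u~k′ w≁k′ k∈K u≁k) w≁k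
      ... | no  u≁k | no  u≁k′ =
        ∖-unique v∈I w∈I (covering k∈K u≁k , w≁k) (covering k′∈K u≁k′ , w≁k′)

    -- A finite search for a counterexample to `Sunflower`; one that is found supplies two sets with
    -- union `K`.
    dichotomy : Sunflower ⊎ Cosunflower
    dichotomy with any? (λ u → any? λ v → any? λ w → any? λ c →
      u ∈? I ×-dec v ∈? I ×-dec w ∈? I ×-dec ¬? (u ≟ v)
      ×-dec adj? u c ×-dec adj? v c ×-dec ¬? (adj? w c))
    ... | yes (u , v , w , c , u∈I , v∈I , w∈I , u≢v , u~c , v~c , w≁c) =
      inj₂ (covering⇒cosunflower u∈I v∈I (missed⇒covering u∈I v∈I w∈I u≢v u~c v~c w≁c))
    ... | no ∄ = inj₁ λ {u} {v} {w} {c} u∈I v∈I w∈I u≢v u~c v~c →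
      decidable-stable (adj? w c) λ w≁c → ∄ (u , v , w , c , u∈I , v∈I , w∈I , u≢v , u~c , v~c , w≁c)

    -- Counting `K ─ U`, and the degree in each case.

    α≡∣K─U∣ : (R : Fin n → Fin n → Set) →
      (∀ {w} → w ∈ I → ∃ λ k → k ∈ K ─ U × R w k) →
      (∀ {w w′ k} → w ∈ I → w′ ∈ I → k ∈ K ─ U → R w k → R w′ k → w ≡ w′) →
      (∀ {k} → k ∈ K ─ U → ∃ λ w → w ∈ I × R w k) →
      (∀ {k k′ w} → k ∈ K ─ U → k′ ∈ K ─ U → w ∈ I → R w k → R w k′ → k ≡ k′) →
      ∣ I ∣ ≡ ∣ K ─ U ∣
    α≡∣K─U∣ R total inj surj func = ≤-antisym
      (injective-relation⇒∣p∣≤∣q∣ I (K ─ U) R total inj)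
      (injective-relation⇒∣p∣≤∣q∣ (K ─ U) I (flip R) surj func)

    K─U⁻ : ∀ {k} → k ∈ K ─ U → k ∈ K × k ∉ U
    K─U⁻ k∈ = p─q⊆p K U k∈ , x∈p─q⇒x∉q K U k∈

    sunflower⇒α≡∣K─U∣ : Sunflower → ∣ I ∣ ≡ ∣ K ─ U ∣
    sunflower⇒α≡∣K─U∣ sunflower = α≡∣K─U∣ Adj total inj surj func
      where
      total : ∀ {w} → w ∈ I → ∃ λ k → k ∈ K ─ U × Adj w k
      total {w} w∈I with another w
      ... | v , v∈I , v≢w with ∖-nonempty w∈I v∈I (≢-sym v≢w)
      ...   | k , w~k , v≁k =
        k , x∈p∧x∉q⇒x∈p─q (neighbour∈K w∈I w~k) (missed⇒∉U v∈I v≁k) , w~k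

      shared⇒∈U : ∀ {w w′ k} → w ∈ I → w′ ∈ I → w ≢ w′ → Adj w k → Adj w′ k → k ∈ U
      shared⇒∈U w∈I w′∈I w≢w′ w~k w′~k =
        U⁺ (neighbour∈K w∈I w~k) λ v∈I → sunflower w∈I w′∈I v∈I w≢w′ w~k w′~k

      inj : ∀ {w w′ k} → w ∈ I → w′ ∈ I → k ∈ K ─ U → Adj w k → Adj w′ k → w ≡ w′
      inj {w} {w′} w∈I w′∈I k∈ w~k w′~k = decidable-stable (w ≟ w′) λ w≢w′ →
        proj₂ (K─U⁻ k∈) (shared⇒∈U w∈I w′∈I w≢w′ w~k w′~k)

      surj : ∀ {k} → k ∈ K ─ U → ∃ λ w → w ∈ I × Adj w k
      surj = covered ∘ proj₁ ∘ K─U⁻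

      func : ∀ {k k′ w} → k ∈ K ─ U → k′ ∈ K ─ U → w ∈ I → Adj w k → Adj w k′ → k ≡ k′
      func {w = w} k∈ k′∈ w∈I w~k w~k′ with another w
      -- By `inj`, an element outside `U` belongs to one set only, so both `k` and `k′` lie in N(w)
      -- ∖ N(v).
      ... | v , v∈I , v≢w = ∖-unique w∈I v∈I (private∈ k∈ w~k) (private∈ k′∈ w~k′)
        where
        private∈ : ∀ {k} → k ∈ K ─ U → Adj w k → k ∈N w ∖N v
        private∈ k∈ w~k = w~k , λ v~k → v≢w (inj v∈I w∈I k∈ v~k w~k)

    cosunflower⇒α≡∣K─U∣ : Cosunflower → ∣ I ∣ ≡ ∣ K ─ U ∣
    cosunflower⇒α≡∣K─U∣ cosunflower = α≡∣K─U∣ (λ w k → ¬ Adj w k) total inj surj func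
      where
      total : ∀ {w} → w ∈ I → ∃ λ k → k ∈ K ─ U × ¬ Adj w k
      total w∈I with missing w∈I
      ... | k , k∈K , w≁k = k , x∈p∧x∉q⇒x∈p─q k∈K (missed⇒∉U w∈I w≁k) , w≁k

      inj : ∀ {w w′ k} → w ∈ I → w′ ∈ I → k ∈ K ─ U → ¬ Adj w k → ¬ Adj w′ k → w ≡ w′
      inj {w} {w′} {k} w∈I w′∈I k∈ w≁k w′≁k = decidable-stable (w ≟ w′) different
        where
        different : ¬ (w ≢ w′)
        different w≢w′ with ∖-nonempty w∈I w′∈I w≢w′
        -- `w′` misses both `p` and `k`, so they coincide, yet `w` is adjacent to `p` and not to
        -- `k`.
        ... | p , w~p , w′≁p = w≁k (subst (Adj w)
          (cosunflower w′∈I (neighbour∈K w∈I w~p) (proj₁ (K─U⁻ k∈)) w′≁p w′≁k) w~p)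

      surj : ∀ {k} → k ∈ K ─ U → ∃ λ w → w ∈ I × ¬ Adj w k
      surj k∈ = U⁻ (proj₁ (K─U⁻ k∈)) (proj₂ (K─U⁻ k∈))

      func : ∀ {k k′ w} → k ∈ K ─ U → k′ ∈ K ─ U → w ∈ I → ¬ Adj w k → ¬ Adj w k′ → k ≡ k′
      func k∈ k′∈ w∈I = cosunflower w∈I (proj₁ (K─U⁻ k∈)) (proj₁ (K─U⁻ k′∈))

    ω≡α+∣U∣ : ∣ K ∣ ≡ ∣ I ∣ + ∣ U ∣
    ω≡α+∣U∣ = trans (∣p∣≡∣p─q∣+∣q∣ K U U⊆K) (cong (_+ ∣ U ∣) (sym (α≡ dichotomy)))
      where
      α≡ : Sunflower ⊎ Cosunflower → ∣ I ∣ ≡ ∣ K ─ U ∣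
      α≡ (inj₁ s) = sunflower⇒α≡∣K─U∣ s
      α≡ (inj₂ c) = cosunflower⇒α≡∣K─U∣ c

    -- For a second vertex `w`, the elements that N(v) shares with N(w) lie in all the sets, hence
    -- in `U`; the single remaining one is `x`.
    sunflower⇒degree≡1+∣U∣ : Sunflower → ∀ {v} → v ∈ I → degree graph v ≡ suc ∣ U ∣
    sunflower⇒degree≡1+∣U∣ sunflower {v} v∈I with another v
    ... | w , w∈I , w≢v with ∖-nonempty v∈I w∈I (≢-sym w≢v)
    ...   | x , v~x , w≁x =
      ∣insert∣ (λ k∈U → ∈N (U⇒adj k∈U v∈I)) (∈N v~x) (missed⇒∉U w∈I w≁x) (split ∘ N⇒adj)
      where
      split : ∀ {k} → Adj v k → k ∈ U ⊎ k ≡ x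
      split {k} v~k with adj? w k
      ... | yes w~k = inj₁ (U⁺ (neighbour∈K v∈I v~k) λ u∈I →
                              sunflower v∈I w∈I u∈I (≢-sym w≢v) v~k w~k)
      ... | no  w≁k = inj₂ (∖-unique v∈I w∈I (v~k , w≁k) (v~x , w≁x))

    cosunflower⇒ω≡1+degree : Cosunflower → ∀ {v} → v ∈ I → ∣ K ∣ ≡ suc (degree graph v)
    cosunflower⇒ω≡1+degree cosunflower {v} v∈I with missing v∈I
    ... | x , x∈K , v≁x = ∣insert∣ (neighbour∈K v∈I ∘ N⇒adj) x∈K (v≁x ∘ N⇒adj) split
      where
      split : ∀ {k} → k ∈ K → k ∈ neighbourhood graph v ⊎ k ≡ x
      split {k} k∈K with adj? v k
      ... | yes v~k = inj₁ (∈N v~k)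
      ... | no  v≁k = inj₂ (cosunflower v∈I k∈K x∈K v≁k v≁x)

    degree≡1+∣U∣⊎ω≡1+degree : ∀ {v} → v ∈ I → degree graph v ≡ suc ∣ U ∣ ⊎ ∣ K ∣ ≡ suc (degree graph v)
    degree≡1+∣U∣⊎ω≡1+degree v∈I with dichotomy
    ... | inj₁ s = inj₁ (sunflower⇒degree≡1+∣U∣ s v∈I)
    ... | inj₂ c = inj₂ (cosunflower⇒ω≡1+degree c v∈I)

    -- Activity and universal vertices.

    -- Each of the four participants of a 2-switch has a non-neighbour among the others.
    active⇒U-empty : Active graph → Empty U
    active⇒U-empty active (k , k∈U) with active k
    ... | a , b , c , d , switch , k∈ = participant switch k∈
      where
      k-universal : Universal graph k
      k-universal = ∈-comprehension⁻ (universal? graph) k∈U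

      participant : ∀ {a b c d} → TwoSwitch graph a b c d → ¬ (k ∈ˡ (a ∷ b ∷ c ∷ d ∷ []))
      participant record { distinct = (_ ∷ a≢c ∷ _) ∷ (_ ∷ b≢d ∷ _) ∷ _ ; ac = a≁c ; bd = b≁d } = λ where
        (here refl)                         → a≁c (k-universal _ (≢-sym a≢c))
        (there (here refl))                 → b≁d (k-universal _ (≢-sym b≢d))
        (there (there (here refl)))         → a≁c (adjSym (k-universal _ a≢c))
        (there (there (there (here refl)))) → b≁d (adjSym (k-universal _ b≢d))

    -- A vertex of `I` is an end of an induced P₄ with any other vertex of `I`. A vertex `x` of `K`
    -- lies in some N(u) and, being outside `U`, is missed by some `v`, so it is an inner vertex of
    -- such a path. The ends of the path give the 2-switch.
    U-empty⇒active : Empty U → Active graph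
    U-empty⇒active U-empty v with K⊎I v
    U-empty⇒active U-empty u | inj₂ u∈I with another u
    ... | v , v∈I , v≢u with ∖-nonempty u∈I v∈I (≢-sym v≢u) | ∖-nonempty v∈I u∈I v≢u
    ...   | x , x∈ | y , y∈ = u , x , y , v , ∈∖⇒twoSwitch u∈I v∈I x∈ y∈ , here refl
    U-empty⇒active U-empty x | inj₁ x∈K with covered x∈K | U⁻ x∈K (λ x∈U → U-empty (x , x∈U))
    ... | u , u∈I , u~x | v , v∈I , v≁x with ∖-nonempty v∈I u∈I (≢-sym (∈∖⇒≢ (u~x , v≁x)))
    ...   | y , y∈ =
      u , x , y , v , ∈∖⇒twoSwitch u∈I v∈I (u~x , v≁x) y∈ , there (here refl)

    -- Arithmetic of ω, α, d and the number of universal vertices.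

    ω≡∣U∣+α : ∣ K ∣ ≡ ∣ U ∣ + ∣ I ∣
    ω≡∣U∣+α = trans ω≡α+∣U∣ (+-comm ∣ I ∣ ∣ U ∣)

    α≤ω : ∣ I ∣ ≤ ∣ K ∣
    α≤ω = subst (∣ I ∣ ≤_) (sym ω≡α+∣U∣) (m≤m+n ∣ I ∣ ∣ U ∣)

    module _ {d} (common : CommonDegree S d) where

      private
        ω = ∣ K ∣
        α = ∣ I ∣
        υ = ∣ U ∣
        open ≡-Reasoning

      1≤d : 1 ≤ d
      1≤d = subst (1 ≤_) (common _ (proj₂ some∈I)) (1≤degree (proj₂ some∈I))

      d≤ω-1 : (+ d) ≤ᶻ (ω ⊖ 1)
      d≤ω-1 = suc≤⇒≤⊖1
        (subst (λ d → suc d ≤ ω) (common _ (proj₂ some∈I)) (degree<ω (proj₂ some∈I)))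

      ∣U∣+1≡d⊎ω≡d+1 : υ + 1 ≡ d ⊎ ω ≡ d + 1
      ∣U∣+1≡d⊎ω≡d+1 = Sum.map
        (λ eq → trans (+-comm υ 1) (trans (sym eq) (common _ (proj₂ some∈I))))
        (λ eq → trans eq (trans (cong suc (common _ (proj₂ some∈I))) (+-comm 1 d)))
        (degree≡1+∣U∣⊎ω≡1+degree (proj₂ some∈I))

      ∣U∣≡d-1⊎∣U∣≡d+1-α : (+ υ ≡ d ⊖ 1) ⊎ (+ υ ≡ (d + 1) ⊖ α)
      ∣U∣≡d-1⊎∣U∣≡d+1-α = Sum.map (Equivalence.from (+≡⊖ _ _ _))
        (λ ω≡d+1 → Equivalence.from (+≡⊖ _ _ _) (trans (sym ω≡∣U∣+α) ω≡d+1)) ∣U∣+1≡d⊎ω≡d+1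

      -- Adding `α` to both sides of υ + 1 = d gives ω + 1 = α + d, because ω = α + υ.
      ∣U∣≡d-1⇔ω≡α+d-1 : (+ υ ≡ d ⊖ 1) ⇔ (+ ω ≡ (α + d) ⊖ 1)
      ∣U∣≡d-1⇔ω≡α+d-1 = mk⇔
        (λ eq → Equivalence.from (+≡⊖ _ _ _) (begin
          ω + 1         ≡⟨ cong (_+ 1) ω≡α+∣U∣ ⟩
          α + υ + 1     ≡⟨ +-assoc α υ 1 ⟩
          α + (υ + 1)   ≡⟨ cong (_+_ α) (Equivalence.to (+≡⊖ _ _ _) eq) ⟩
          α + d         ∎))
        (λ eq → Equivalence.from (+≡⊖ _ _ _) (+-cancelˡ-≡ α _ _ (begin
          α + (υ + 1)   ≡⟨ +-assoc α υ 1 ⟨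
          α + υ + 1     ≡⟨ cong (_+ 1) ω≡α+∣U∣ ⟨
          ω + 1         ≡⟨ Equivalence.to (+≡⊖ _ _ _) eq ⟩
          α + d         ∎)))

      ∣U∣≡d+1-α⇔ω≡d+1 : (+ υ ≡ (d + 1) ⊖ α) ⇔ (ω ≡ d + 1)
      ∣U∣≡d+1-α⇔ω≡d+1 = mk⇔
        (λ eq → trans ω≡∣U∣+α (Equivalence.to (+≡⊖ _ _ _) eq))
        (λ eq → Equivalence.from (+≡⊖ _ _ _) (trans (sym ω≡∣U∣+α) eq))

      active⇒ω≡α×d∈[1,ω-1] : Active graph → (ω ≡ α) × ((d ≡ 1) ⊎ (+ d ≡ ω ⊖ 1))
      active⇒ω≡α×d∈[1,ω-1] active =
        trans ω≡∣U∣+α (cong (_+ α) ∣U∣≡0) ,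
        Sum.map (λ υ+1≡d → trans (sym υ+1≡d) (cong (_+ 1) ∣U∣≡0))
                (λ ω≡d+1 → Equivalence.from (+≡⊖ _ _ _) (sym ω≡d+1))
                ∣U∣+1≡d⊎ω≡d+1
        where
        ∣U∣≡0 : υ ≡ 0
        ∣U∣≡0 = Empty⇒∣p∣≡0 (active⇒U-empty active)

      ω≡α⊎d≡1⇒active : (ω ≡ α) ⊎ (d ≡ 1) → Active graph
      ω≡α⊎d≡1⇒active h = U-empty⇒active (∣p∣≡0⇒Empty (∣U∣≡0 h ∣U∣+1≡d⊎ω≡d+1))
        where
        ∣U∣≡0 : (ω ≡ α) ⊎ (d ≡ 1) → υ + 1 ≡ d ⊎ ω ≡ d + 1 → υ ≡ 0
        ∣U∣≡0 (inj₁ ω≡α) _            = +-cancelʳ-≡ α υ 0 (trans (sym ω≡∣U∣+α) ω≡α)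
        ∣U∣≡0 (inj₂ d≡1) (inj₁ υ+1≡d) = +-cancelʳ-≡ 1 υ 0 (trans υ+1≡d d≡1)
        -- Here υ + α = ω = 2, and α ≥ 2 leaves nothing for `υ`.
        ∣U∣≡0 (inj₂ d≡1) (inj₂ ω≡d+1) = n≤0⇒n≡0 (+-cancelʳ-≤ α υ 0 (subst (_≤ α) 2≡υ+α 2≤α))
          where
          2≡υ+α : 2 ≡ υ + α
          2≡υ+α = begin
            2       ≡⟨ cong (_+ 1) d≡1 ⟨
            d + 1   ≡⟨ ω≡d+1 ⟨
            ω       ≡⟨ ω≡∣U∣+α ⟩
            υ + α   ∎

theorem4p3 : ∀ {n} (S : SplitGraph n) →
    let open SplitGraph S
        ω = ∣ K ∣
        α = ∣ I ∣
        U = universals graph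
    in
    Simple (Φ S) → Complete (underlying (Φ S)) →
    (∀ k → k ∈ K ⇔ (∃ λ v → v ∈ I × k ∈ neighbourhood graph v)) →
    2 ≤ α →
      Homogeneous S
    × (∀ d → CommonDegree S d →
          (1 ≤ d × (+ d) ≤ᶻ (ω ⊖ 1))
        × ((+ ∣ U ∣ ≡ d ⊖ 1) ⊎ (+ ∣ U ∣ ≡ (d + 1) ⊖ α))
        × ((+ ∣ U ∣ ≡ d ⊖ 1) ⇔ (+ ω ≡ (α + d) ⊖ 1))
        × ((+ ∣ U ∣ ≡ (d + 1) ⊖ α) ⇔ (ω ≡ d + 1)))
    × (ω ≡ α + ∣ U ∣ × α ≤ ω)
    × (Active graph ⇔ Empty U)
    × (∀ d → CommonDegree S d →
          (Active graph → (ω ≡ α) × ((d ≡ 1) ⊎ (+ d ≡ ω ⊖ 1)))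
        × ((ω ≡ α) ⊎ (d ≡ 1) → Active graph))
theorem4p3 S simple complete union 2≤α =
    (balanced , _ , commonDegree)
  , (λ d common → (1≤d common , d≤ω-1 common)
                , ∣U∣≡d-1⊎∣U∣≡d+1-α common
                , ∣U∣≡d-1⇔ω≡α+d-1 common
                , ∣U∣≡d+1-α⇔ω≡d+1 common)
  , (ω≡α+∣U∣ , α≤ω)
  , mk⇔ active⇒U-empty U-empty⇒active
  , λ d common → active⇒ω≡α×d∈[1,ω-1] common , ω≡α⊎d≡1⇒active common
  where
  open SplitGraph S
  open SplitGraphProperties S

  covered : ∀ {k} → k ∈ K → ∃ λ v → v ∈ I × Graph.Adj graph v k
  covered {k} k∈K = let v , v∈I , k∈Nv = Equivalence.to (union k) k∈K
                    in  v , v∈I , ∈-comprehension⁻ (Graph.adj? graph v) k∈Nv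

  ∖-nonempty : ∀ {u v} → u ∈ I → v ∈ I → u ≢ v → ∃ λ x → x ∈N u ∖N v
  ∖-nonempty = complete⇒∖-nonempty complete

  ∖-unique : ∀ {u v x x′} → u ∈ I → v ∈ I → x ∈N u ∖N v → x′ ∈N u ∖N v → x ≡ x′
  ∖-unique u∈I v∈I x∈ x′∈ =
    -- Completeness supplies the `y` in N(v) ∖ N(u) that completes both paths.
    simple⇒∖-unique simple u∈I v∈I x∈ x′∈ (proj₂ (∖-nonempty v∈I u∈I (≢-sym (∈∖⇒≢ x∈))))

  open UnitDifferences ∖-nonempty ∖-unique covered 2≤α
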